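{- We have the $\mathrm{des}$-Wilf equivalence $\underline{213}4\overset{\mathrm{des}}{\sim}\underline{132}4$.
   Context: $\mathfrak{S}_n$ is the set of permutations of $\{1,\ldots,n\}$ in one-line notation, and $\mathrm{des}(\pi)=|\{i\in[n-1]:\pi_i>\pi_{i+1}\}|$. An occurrence of the pattern $\underline{abc}d$ (where $abcd\in\mathfrak{S}_4$) in $\pi$ is a subsequence $\pi_i\pi_{i+1}\pi_{i+2}\pi_j$ with $j>i+2$ order-isomorphic to $abcd$. $\mathfrak{S}_n(\omega)$ is the set of permutations in $\mathfrak{S}_n$ with no occurrence of $\omega$. $\omega\overset{\mathrm{des}}{\sim}\omega'$ means $|\{\pi\in\mathfrak{S}_n(\omega):\mathrm{des}(\pi)=m\}|=|\{\pi\in\mathfrak{S}_n(\omega'):\mathrm{des}(\pi)=m\}|$ for all $n\ge1$ and $m\ge0$. -}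

module Defs where

open import Data.Fin.Base using (Fin; toℕ; inject₁; suc; _<_)
open import Data.Fin.Properties using (all?; any?; _<?_; _≟_)
open import Data.List.Base using (List; []; _∷_; allFin; cartesianProductWith; filter; length)
open import Data.List.Membership.Propositional using (_∈_)
open import Data.List.Membership.Propositional.Properties using (∈-allFin; ∈-cartesianProductWith⁺; ∈-filter⁺; ∈-filter⁻)
open import Data.List.Relation.Unary.All using ([])
open import Data.List.Relation.Unary.AllPairs using ([]; _∷_)
open import Data.List.Relation.Unary.Any using (here)
import Data.List.Relation.Unary.Unique.Propositional as ListUnique
open import Data.List.Relation.Unary.Unique.Propositional.Properties using (cartesianProductWith⁺; allFin⁺; filter⁺)
open import Data.Nat.Base using (ℕ; zero; suc; _+_; _≤_)
import Data.Nat.Properties as ℕₚ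
open import Data.Product.Base using (∃-syntax; _×_; _,_; proj₂)
open import Data.Vec.Base using (Vec; []; _∷_; lookup)
open import Data.Vec.Properties using (∷-injective)
open import Data.Vec.Relation.Unary.AllPairs using (allPairs?)
open import Data.Vec.Relation.Unary.Unique.Propositional using (Unique)
open import Function.Bundles using (_⇔_; mk⇔; Equivalence)
open import Relation.Binary.PropositionalEquality.Core using (_≡_; refl)
open import Relation.Nullary.Decidable using (Dec; map′; ¬?; _×-dec_; _→-dec_)
open import Relation.Nullary.Negation using (¬_)
open import Relation.Unary using (Decidable)

-- Letters and positions are shifted down by one: the word π₁ … πₙ over
-- {1, …, n} is represented by the vector of the elements πᵢ - 1 of Fin n.

words : ∀ k n → List (Vec (Fin n) k)
words zero    n = [] ∷ []
words (suc k) n = cartesianProductWith _∷_ (allFin n) (words k n)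

unique? : ∀ {k n} → Decidable (Unique {A = Fin n} {k})
unique? = allPairs? (λ x y → ¬? (x ≟ y))

-- A word of length n over n letters is a permutation exactly when its
-- letters are distinct.
𝔖 : ∀ n → List (Vec (Fin n) n)
𝔖 n = filter unique? (words n n)

-- The list enumerates each permutation exactly once, so that the lengths
-- of its filtrations are cardinalities.

∈-words : ∀ {k n} (w : Vec (Fin n) k) → w ∈ words k n
∈-words []      = here refl
∈-words (x ∷ w) = ∈-cartesianProductWith⁺ _∷_ (∈-allFin x) (∈-words w)

words-unique : ∀ k n → ListUnique.Unique (words k n)
words-unique zero    n = [] ∷ []
words-unique (suc k) n =
  cartesianProductWith⁺ _∷_ ∷-injective (allFin⁺ n) (words-unique k n)

∈-𝔖 : ∀ {n} {π : Vec (Fin n) n} → π ∈ 𝔖 n ⇔ Unique π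
∈-𝔖 {n} {π} = mk⇔ (λ π∈ → proj₂ (∈-filter⁻ unique? {xs = words n n} π∈))
                   (∈-filter⁺ unique? (∈-words π))

𝔖-unique : ∀ n → ListUnique.Unique (𝔖 n)
𝔖-unique n = filter⁺ unique? (words-unique n n)

des : ∀ {k n} → Vec (Fin n) k → ℕ
des {zero}  π = 0
des {suc k} π =
  length (filter (λ i → lookup π (suc i) <? lookup π (inject₁ i)) (allFin k))

OrderIsomorphic : ∀ {k m n} → Vec (Fin m) k → Vec (Fin n) k → Set
OrderIsomorphic u v =
  ∀ a b → (lookup u a < lookup u b) ⇔ (lookup v a < lookup v b)

-- Occurrences of the vincular pattern whose first three letters are
-- underlined.
Occurs : ∀ {n} → Vec (Fin 4) 4 → Vec (Fin n) n → Set
Occurs ω π =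
  ∃[ i ] ∃[ i′ ] ∃[ i″ ] ∃[ j ]
    toℕ i′ ≡ 1 + toℕ i × toℕ i″ ≡ 2 + toℕ i × i″ < j ×
    OrderIsomorphic (lookup π i ∷ lookup π i′ ∷ lookup π i″ ∷ lookup π j ∷ []) ω

Avoids : ∀ {n} → Vec (Fin 4) 4 → Vec (Fin n) n → Set
Avoids ω π = ¬ Occurs ω π

orderIsomorphic? : ∀ {k m n} (u : Vec (Fin m) k) (v : Vec (Fin n) k) →
                   Dec (OrderIsomorphic u v)
orderIsomorphic? u v = all? λ a → all? λ b →
  let p = lookup u a <? lookup u b
      q = lookup v a <? lookup v b
  in map′ (λ (f , g) → mk⇔ f g) (λ e → Equivalence.to e , Equivalence.from e)
          ((p →-dec q) ×-dec (q →-dec p))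

avoids? : ∀ {n} (ω : Vec (Fin 4) 4) → Decidable (Avoids {n} ω)
avoids? ω π = ¬? (any? λ i → any? λ i′ → any? λ i″ → any? λ j →
  (toℕ i′ ℕₚ.≟ 1 + toℕ i) ×-dec (toℕ i″ ℕₚ.≟ 2 + toℕ i) ×-dec (i″ <? j) ×-dec
  orderIsomorphic? (lookup π i ∷ lookup π i′ ∷ lookup π i″ ∷ lookup π j ∷ []) ω)

𝔖[_] : Vec (Fin 4) 4 → ∀ n → List (Vec (Fin n) n)
𝔖[ ω ] n = filter (avoids? ω) (𝔖 n)

infix 4 _∼des_

_∼des_ : Vec (Fin 4) 4 → Vec (Fin 4) 4 → Set
ω ∼des ω′ = ∀ n m → 1 ≤ n →
  length (filter (λ π → des π ℕₚ.≟ m) (𝔖[ ω ] n)) ≡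
  length (filter (λ π → des π ℕₚ.≟ m) (𝔖[ ω′ ] n))

{-# OPTIONS --safe #-}
module Submission where

-- Cut a permutation after each of its right-to-left maxima, π = w₁ m₁ w₂ m₂ ⋯,
-- so that m₁ > m₂ > ⋯ and the letters of wᵢ are smaller than mᵢ.  A window of
-- three letters that contains some mᵢ has no larger letter to its right, while a
-- window inside wᵢ is followed by mᵢ; hence π avoids \underline{abc}4 iff every
-- wᵢ avoids abc consecutively.  Replacing each wᵢ by its reverse-complement
-- within its own set of letters preserves des and exchanges 213 with 132.

open import Defs
open import Data.Empty using (⊥-elim)
open import Data.Fin.Base using (Fin; zero; suc; toℕ; inject₁; _<_; _>_)
open import Data.Fin.Patterns using (0F; 1F; 2F; 3F)
import Data.Fin.Properties as Finₚ
open import Data.Fin.Properties using (_<?_; _≟_; <-cmp; <-trans; <-irrefl; <-asym)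
open import Data.Bool.Base using (true; false; if_then_else_)
open import Data.List.Base using (List; []; _∷_; [_]; _++_; map; reverse; length; filter; allFin; tabulate)
import Data.List.Base as List
import Data.List.Properties as Listₚ
open import Data.List.Membership.Propositional using (_∈_)
open import Data.List.Membership.Propositional.Properties using (∈-lookup; ∈-filter⁺; ∈-filter⁻; ∈-++⁺ʳ)
open import Data.List.Relation.Binary.Permutation.Propositional as Perm using (_↭_; ↭-sym; ↭-trans; ↭-refl; ↭-prep; ↭-reflexive)
open import Data.List.Relation.Binary.Permutation.Propositional.Properties using (All-resp-↭; ∈-resp-↭; ↭-length; ↭-reverse)
import Data.List.Relation.Binary.Permutation.Propositional.Properties as Permₚ
import Data.List.Relation.Binary.Permutation.Setoid.Properties as PermSetoidₚ
open import Data.List.Relation.Binary.Pointwise using (Pointwise-≡⇒≡)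
open import Data.List.Relation.Unary.All as All using (All; []; _∷_)
import Data.List.Relation.Unary.All.Properties as Allₚ
open import Data.List.Relation.Unary.AllPairs as AllPairs using (AllPairs; []; _∷_)
import Data.List.Relation.Unary.AllPairs.Properties as AllPairsₚ
open import Data.List.Relation.Unary.Any as Any using (Any; here; there)
import Data.List.Relation.Unary.Any.Properties as Anyₚ
open import Data.List.Relation.Unary.Sorted.TotalOrder.Properties using (Sorted⇒AllPairs; ↗↭↗⇒≋)
open import Data.List.Relation.Unary.Unique.Propositional using (Unique)
import Data.List.Relation.Unary.Unique.Propositional.Properties as Uniqueₚ
open import Data.Nat.Base using (ℕ; zero; suc; _+_; _≤_; s≤s; z≤n)
import Data.Nat.Properties as ℕₚ
open import Data.Product.Base using (∃-syntax; _×_; _,_; proj₁; proj₂; uncurry; map₂)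
open import Data.Sum.Base as Sum using (_⊎_; inj₁; inj₂)
open import Data.Vec.Base as Vec using (Vec; []; _∷_; lookup; toList; fromList)
import Data.Vec.Membership.Propositional.Properties as VecMembershipₚ
import Data.Vec.Properties as Vecₚ
import Data.Vec.Relation.Unary.All.Properties as VecAllₚ
import Data.Vec.Relation.Unary.Any as VecAny
import Data.Vec.Relation.Unary.Any.Properties as VecAnyₚ
open import Data.Vec.Relation.Unary.AllPairs using ([]; _∷_)
open import Data.Vec.Relation.Unary.Linked using (Linked; [-]; _∷_)
import Data.Vec.Relation.Unary.Linked.Properties as Linkedₚ
import Data.Vec.Relation.Unary.Unique.Propositional as VecUnique
open import Function.Base using (_∘_; flip; id)
open import Function.Bundles using (_⇔_; mk⇔; Equivalence)
open import Level using (Level)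
open import Relation.Binary.Core using (Rel)
open import Relation.Binary.Definitions using (tri<; tri≈; tri>)
open import Relation.Binary.PropositionalEquality using (_≡_; _≢_; refl; sym; trans; cong; cong₂; subst; setoid; module ≡-Reasoning)
open import Relation.Nullary.Decidable using (does; dec-true; dec-false; yes; no)
open import Relation.Nullary.Negation using (¬_; contradiction)
open import Relation.Unary using (Decidable)

open Equivalence using (to; from)

private
  variable
    a : Level
    A B : Set a
    k n : ℕ

-- Counting along an injective relation

lookup-injective : {xs : List A} → Unique xs →
                   ∀ i j → List.lookup xs i ≡ List.lookup xs j → i ≡ j
lookup-injective (_  ∷ _)  zero    zero    _  = refl
lookup-injective (x≢ ∷ _)  zero    (suc j) eq = ⊥-elim (All.lookup x≢ (∈-lookup j) eq)
lookup-injective (x≢ ∷ _)  (suc i) zero    eq = ⊥-elim (All.lookup x≢ (∈-lookup i) (sym eq))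
lookup-injective (_  ∷ xs) (suc i) (suc j) eq = cong suc (lookup-injective xs i j eq)

-- Sending each position of `xs` to the position in `ys` of a related element is an injection
-- between finite sets. Since `R` may be any relation, the block map can be given by its graph
-- alone.
length-≤ : {xs : List A} {ys : List B} (R : A → B → Set) → Unique xs →
           (∀ {x} → x ∈ xs → ∃[ y ] y ∈ ys × R x y) →
           (∀ {x x′ y} → R x y → R x′ y → x ≡ x′) →
           length xs ≤ length ys
length-≤ {xs = xs} {ys} R xs! total inj = Finₚ.injective⇒≤ {f = f} f-injective
  where
  f : Fin (length xs) → Fin (length ys)
  f i = Any.index (proj₁ (proj₂ (total (∈-lookup {xs = xs} i))))

  f-image : ∀ i → R (List.lookup xs i) (List.lookup ys (f i))
  f-image i with total (∈-lookup {xs = xs} i)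
  ... | y , y∈ , r = subst (R _) (Anyₚ.lookup-index y∈) r

  f-injective : ∀ {i j} → f i ≡ f j → i ≡ j
  f-injective {i} {j} eq = lookup-injective xs! i j
    (inj (f-image i) (subst (λ h → R _ (List.lookup ys h)) (sym eq) (f-image j)))

Unique-resp-↭ : {xs ys : List A} → xs ↭ ys → Unique xs → Unique ys
Unique-resp-↭ p = PermSetoidₚ.Unique-resp-↭ (setoid _) (Perm.↭⇒↭ₛ p)

AllPairs-reverse : {R : Rel A a} {xs : List A} → AllPairs R xs → AllPairs (flip R) (reverse xs)
AllPairs-reverse [] = []
AllPairs-reverse {R = R} {xs = x ∷ xs} (px ∷ pxs) =
  subst (AllPairs (flip R)) (sym (Listₚ.unfold-reverse x xs))
    (AllPairsₚ.++⁺ (AllPairs-reverse pxs) ([] ∷ [])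
      (All.map (_∷ []) (All-resp-↭ (↭-sym (↭-reverse xs)) px)))

-- Weighted sums over adjacent letters

-- The weight is a parameter because reversing a list flips it, and `flip drop` is not `drop`.
steps : (A → A → ℕ) → List A → ℕ
steps f []          = 0
steps f (x ∷ [])    = 0
steps f (x ∷ y ∷ l) = f x y + steps f (y ∷ l)

steps-++ : (f : A → A → ℕ) (l : List A) (x : A) (r : List A) →
           steps f (l ++ x ∷ r) ≡ steps f (l ++ [ x ]) + steps f (x ∷ r)
steps-++ f []          x r = refl
steps-++ f (y ∷ [])    x r = cong (_+ steps f (x ∷ r)) (sym (ℕₚ.+-identityʳ (f y x)))
steps-++ f (y ∷ z ∷ l) x r = trans (cong (f y z +_) (steps-++ f (z ∷ l) x r))
                                   (sym (ℕₚ.+-assoc (f y z) _ _))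

steps-reverse : (f : A → A → ℕ) (l : List A) → steps f (reverse l) ≡ steps (flip f) l
steps-reverse f []          = refl
steps-reverse f (x ∷ [])    = refl
steps-reverse f (x ∷ y ∷ l) = begin
  steps f (reverse (x ∷ y ∷ l))                        ≡⟨ cong (steps f) (Listₚ.reverse-++ (x ∷ y ∷ []) l) ⟩
  steps f (reverse l ++ y ∷ x ∷ [])                    ≡⟨ steps-++ f (reverse l) y [ x ] ⟩
  steps f (reverse l ++ [ y ]) + (f y x + 0)           ≡⟨ cong₂ _+_ (cong (steps f) (Listₚ.unfold-reverse y l)) (sym (ℕₚ.+-identityʳ (f y x))) ⟨
  steps f (reverse (y ∷ l)) + f y x                    ≡⟨ cong (_+ f y x) (steps-reverse f (y ∷ l)) ⟩
  steps (flip f) (y ∷ l) + f y x                       ≡⟨ ℕₚ.+-comm _ (f y x) ⟩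
  f y x + steps (flip f) (y ∷ l)                       ∎
  where open ≡-Reasoning

-- The hypothesis is confined to letters of `l` because `complement w` is controlled on the letters
-- of `w` alone.
steps-map : (f : B → B → ℕ) (g : A → A → ℕ) (c : A → B) {l : List A} →
            (∀ {x y} → x ∈ l → y ∈ l → f (c x) (c y) ≡ g x y) →
            steps f (map c l) ≡ steps g l
steps-map f g c {[]}        _  = refl
steps-map f g c {x ∷ []}    _  = refl
steps-map f g c {x ∷ y ∷ l} eq =
  cong₂ _+_ (eq (here refl) (there (here refl)))
            (steps-map f g c (λ x∈ y∈ → eq (there x∈) (there y∈)))

-- Consecutive patterns of length three

Pattern : Set → Set₁
Pattern A = A → A → A → Set

data Consecutive {A : Set} (P : Pattern A) : List A → Set where
  here  : ∀ {x y z l} → P x y z → Consecutive P (x ∷ y ∷ z ∷ l)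
  there : ∀ {x l} → Consecutive P l → Consecutive P (x ∷ l)

module _ {A : Set} {P : Pattern A} where

  Consecutive-++⁺ˡ : ∀ {l} r → Consecutive P l → Consecutive P (l ++ r)
  Consecutive-++⁺ˡ r (here p)  = here p
  Consecutive-++⁺ˡ r (there o) = there (Consecutive-++⁺ˡ r o)

  Consecutive-++⁺ʳ : ∀ l {r} → Consecutive P r → Consecutive P (l ++ r)
  Consecutive-++⁺ʳ []      o = o
  Consecutive-++⁺ʳ (x ∷ l) o = there (Consecutive-++⁺ʳ l o)

Consecutive-reverse : {A : Set} {P : Pattern A} {l : List A} →
  Consecutive P l → Consecutive (λ x y z → P z y x) (reverse l)
Consecutive-reverse (here {x} {y} {z} {l} p) =
  subst (Consecutive _) (sym (Listₚ.reverse-++ (x ∷ y ∷ z ∷ []) l))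
    (Consecutive-++⁺ʳ (reverse l) (here p))
Consecutive-reverse (there {x} {l} o) =
  subst (Consecutive _) (sym (Listₚ.unfold-reverse x l))
    (Consecutive-++⁺ˡ [ x ] (Consecutive-reverse o))

Consecutive-map⁻ : {A B : Set} {P : Pattern B} {Q : Pattern A} {c : A → B} {l : List A} →
  (∀ {x y z} → x ∈ l → y ∈ l → z ∈ l → P (c x) (c y) (c z) → Q x y z) →
  Consecutive P (map c l) → Consecutive Q l
Consecutive-map⁻ {l = x ∷ y ∷ z ∷ l} f (here p) =
  here (f (here refl) (there (here refl)) (there (there (here refl))) p)
Consecutive-map⁻ {l = x ∷ l} f (there o) =
  there (Consecutive-map⁻ (λ x∈ y∈ z∈ → f (there x∈) (there y∈) (there z∈)) o)

-- Occurrences followed by a larger letter, and right-to-left maxima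

Above : Fin n → Fin n → Fin n → Fin n → Set
Above x y z d = x < d × y < d × z < d

-- When the last letter of a pattern is its largest, the order conditions split into `P` on the
-- three adjacent letters and `Above` for the fourth.
data Occurrence {n} (P : Pattern (Fin n)) : List (Fin n) → Set where
  here  : ∀ {x y z l} → P x y z → Any (Above x y z) l → Occurrence P (x ∷ y ∷ z ∷ l)
  there : ∀ {x l} → Occurrence P l → Occurrence P (x ∷ l)

no-larger : {m : Fin n} {Q : Fin n → Set} {r : List (Fin n)} →
            All (_< m) r → (∀ {d} → Q d → m < d) → ¬ Any Q r
no-larger r<m m<d q with d<m , qd ← All.lookupAny r<m q = <-asym d<m (m<d qd)

module _ {n} {P : Pattern (Fin n)} {m : Fin n} {r : List (Fin n)} where

  Occurrence-block⁻ : ∀ w → All (_< m) w → All (_< m) r →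
    Occurrence P (w ++ m ∷ r) → Consecutive P w ⊎ Occurrence P r
  -- In the three clauses with `no-larger`, `m` is the first, second and third letter of the window;
  -- the fourth letter then lies in `r` and cannot exceed `m`.
  Occurrence-block⁻ [] _ (_ ∷ _ ∷ r<m) (here _ d) = ⊥-elim (no-larger r<m proj₁ d)
  Occurrence-block⁻ [] _ _ (there o) = inj₂ o
  Occurrence-block⁻ (x ∷ []) _ (_ ∷ r<m) (here _ d) = ⊥-elim (no-larger r<m (proj₁ ∘ proj₂) d)
  Occurrence-block⁻ (x ∷ y ∷ []) _ r<m (here _ d) = ⊥-elim (no-larger r<m (proj₂ ∘ proj₂) d)
  Occurrence-block⁻ (x ∷ y ∷ z ∷ w) _ _ (here p _) = inj₁ (here p)
  Occurrence-block⁻ (x ∷ w) (_ ∷ w<m) r<m (there o) = Sum.map₁ there (Occurrence-block⁻ w w<m r<m o)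

  Occurrence-block⁺ : ∀ w → All (_< m) w →
    Consecutive P w ⊎ Occurrence P r → Occurrence P (w ++ m ∷ r)
  Occurrence-block⁺ [] _ (inj₂ o) = there o
  Occurrence-block⁺ (x ∷ w) (_ ∷ w<m) (inj₂ o) = there (Occurrence-block⁺ w w<m (inj₂ o))
  Occurrence-block⁺ (x ∷ y ∷ z ∷ w) (x<m ∷ y<m ∷ z<m ∷ _) (inj₁ (here p)) =
    -- The letter `m` that closes the block serves as the fourth letter.
    here p (Anyₚ.++⁺ʳ w (here (x<m , y<m , z<m)))
  Occurrence-block⁺ (x ∷ w) (_ ∷ w<m) (inj₁ (there o)) = there (Occurrence-block⁺ w w<m (inj₁ o))

-- Descents of lists

drop : Fin n → Fin n → ℕ
drop x y = if does (y <? x) then 1 else 0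

drop-> : {x y : Fin n} → y < x → drop x y ≡ 1
drop-> {x = x} {y} y<x = cong (if_then 1 else 0) (dec-true (y <? x) y<x)

drop-≯ : {x y : Fin n} → ¬ y < x → drop x y ≡ 0
drop-≯ {x = x} {y} y≮x = cong (if_then 1 else 0) (dec-false (y <? x) y≮x)

drop-< : {x y : Fin n} → x < y → drop x y ≡ 0
drop-< x<y = drop-≯ (<-asym x<y)

drop-refl : (x : Fin n) → drop x x ≡ 0
drop-refl x = drop-≯ {x = x} (<-irrefl refl)

descents : List (Fin n) → ℕ
descents = steps drop

descents-∷ʳ-max : {m : Fin n} (w : List (Fin n)) → All (_< m) w → descents (w ++ [ m ]) ≡ descents w
descents-∷ʳ-max []          _               = refl
descents-∷ʳ-max (x ∷ [])    (x<m ∷ _)       = cong (_+ 0) (drop-< x<m)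
descents-∷ʳ-max (x ∷ y ∷ w) (_ ∷ w<m)       = cong (drop x y +_) (descents-∷ʳ-max (y ∷ w) w<m)

-- The step out of `m` is a descent whatever letter follows; the permutation ensures that a letter
-- follows on both sides or on neither, and that it is below `m`.
descents-max-∷ : {m : Fin n} {r r′ : List (Fin n)} → All (_< m) r → r ↭ r′ →
                 descents r ≡ descents r′ → descents (m ∷ r) ≡ descents (m ∷ r′)
descents-max-∷ {r = []}    {[]}     _ _ _ = refl
descents-max-∷ {r = []}    {y ∷ r′} _ p _ with () ← ↭-length p
descents-max-∷ {r = x ∷ r} {[]}     _ p _ with () ← ↭-length p
descents-max-∷ {r = x ∷ r} {y ∷ r′} (x<m ∷ r<m) p eq with y<m ∷ _ ← All-resp-↭ p (x<m ∷ r<m) =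
  cong₂ _+_ (trans (drop-> x<m) (sym (drop-> y<m))) eq

-- Relative complement

-- The value at x ∉ s is the junk value x.
transport : List (Fin n) → List (Fin n) → Fin n → Fin n
transport (a ∷ s) (b ∷ t) x with x ≟ a
... | yes _ = b
... | no  _ = transport s t x
transport _ _ x = x

transport-∈ : ∀ (s t : List (Fin n)) {x} → length s ≡ length t → x ∈ s → transport s t x ∈ t
transport-∈ (a ∷ s) (b ∷ t) {x} eq x∈ with x ≟ a | x∈
... | yes _  | _        = here refl
... | no x≢a | here x≡a = contradiction x≡a x≢a
... | no _   | there x∈ = there (transport-∈ s t (ℕₚ.suc-injective eq) x∈)

-- The head of `s` is its least letter and goes to the greatest letter of `t`; the remaining letters
-- are handled by the tails.
transport-anti : ∀ {s t : List (Fin n)} {x y} → length s ≡ length t →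
                 AllPairs _<_ s → AllPairs _>_ t → x ∈ s → y ∈ s → x < y →
                 transport s t y < transport s t x
transport-anti {s = a ∷ s} {b ∷ t} {x} {y} eq (a<s ∷ s↗) (b>t ∷ t↘) x∈ y∈ x<y
  with x ≟ a | y ≟ a | x∈ | y∈
... | yes refl | yes refl | _        | _        = contradiction x<y (<-irrefl refl)
... | yes _    | no y≢a   | _        | here y≡a = contradiction y≡a y≢a
... | yes _    | no _     | _        | there y∈ = All.lookup b>t (transport-∈ s t (ℕₚ.suc-injective eq) y∈)
... | no x≢a   | _        | here x≡a | _        = contradiction x≡a x≢a
... | no _     | yes refl | there x∈ | _        = contradiction x<y (<-asym (All.lookup a<s x∈))
... | no _     | no y≢a   | there _  | here y≡a = contradiction y≡a y≢a
... | no _     | no _     | there x∈ | there y∈ = transport-anti (ℕₚ.suc-injective eq) s↗ t↘ x∈ y∈ x<y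

map-transport : ∀ {s t : List (Fin n)} → length s ≡ length t → Unique s → map (transport s t) s ≡ t
map-transport {s = []}    {[]}    _  _          = refl
map-transport {s = a ∷ s} {b ∷ t} eq (a≢s ∷ s!) = cong₂ _∷_ head-eq
  (trans (Listₚ.map-cong-local (All.map tail-eq a≢s)) (map-transport (ℕₚ.suc-injective eq) s!))
  where
  head-eq : transport (a ∷ s) (b ∷ t) a ≡ b
  head-eq with a ≟ a
  ... | yes _  = refl
  ... | no a≢a = contradiction refl a≢a

  tail-eq : ∀ {x} → a ≢ x → transport (a ∷ s) (b ∷ t) x ≡ transport s t x
  tail-eq {x} a≢x with x ≟ a
  ... | yes x≡a = contradiction (sym x≡a) a≢x
  ... | no _    = refl

module _ {n : ℕ} where

  open import Data.List.Sort (Finₚ.≤-decTotalOrder n) public using (sort; sort-↭; sort-↗)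

  -- Makes `complement w` depend on the letters of `w` and not on their order, which the injectivity
  -- of `reverseComplement` rests on.
  sort-cong : {w w′ : List (Fin n)} → w ↭ w′ → sort w ≡ sort w′
  sort-cong {w} {w′} p = Pointwise-≡⇒≡ (↗↭↗⇒≋ (Finₚ.≤-totalOrder n) (sort-↗ w) (sort-↗ w′)
    (Perm.↭⇒↭ₛ (↭-trans (sort-↭ w) (↭-trans p (↭-sym (sort-↭ w′))))))

  -- For distinct letters, the i-th smallest is matched with the i-th largest.
  complement : List (Fin n) → Fin n → Fin n
  complement w = transport (sort w) (reverse (sort w))

  reverseComplement : List (Fin n) → List (Fin n)
  reverseComplement w = map (complement w) (reverse w)

  module _ {w : List (Fin n)} (w! : Unique w) where

    private
      s! : Unique (sort w)
      s! = Unique-resp-↭ (↭-sym (sort-↭ w)) w!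

      s↗ : AllPairs _<_ (sort w)
      s↗ = AllPairs.zipWith (uncurry Finₚ.≤∧≢⇒<) (Sorted⇒AllPairs (Finₚ.≤-totalOrder n) (sort-↗ w) , s!)

      ∈-sort : ∀ {x} → x ∈ w → x ∈ sort w
      ∈-sort = ∈-resp-↭ (↭-sym (sort-↭ w))

      |s| : length (sort w) ≡ length (reverse (sort w))
      |s| = sym (Listₚ.length-reverse (sort w))

    complement-anti : ∀ {x y} → x ∈ w → y ∈ w → x < y → complement w y < complement w x
    complement-anti x∈ y∈ = transport-anti |s| s↗ (AllPairs-reverse s↗) (∈-sort x∈) (∈-sort y∈)

    complement-anti⁻ : ∀ {x y} → x ∈ w → y ∈ w → complement w x < complement w y → y < x
    complement-anti⁻ {x} {y} x∈ y∈ cx<cy with <-cmp x y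
    ... | tri< x<y _    _   = contradiction cx<cy (<-asym (complement-anti x∈ y∈ x<y))
    ... | tri≈ _   refl _   = contradiction cx<cy (<-irrefl refl)
    ... | tri> _   _    y<x = y<x

    complement-injective : ∀ {x y} → x ∈ w → y ∈ w → complement w x ≡ complement w y → x ≡ y
    complement-injective {x} {y} x∈ y∈ eq with <-cmp x y
    ... | tri< x<y _   _   = contradiction (complement-anti x∈ y∈ x<y) (<-irrefl (sym eq))
    ... | tri≈ _   x≡y _   = x≡y
    ... | tri> _   _   y<x = contradiction (complement-anti y∈ x∈ y<x) (<-irrefl eq)

    -- Up to rearrangement the complement may be applied to the sorted letters, where it just
    -- reverses the list.
    reverseComplement-↭ : reverseComplement w ↭ w
    reverseComplement-↭ = begin
      map (complement w) (reverse w) ↭⟨ Permₚ.map⁺ _ (↭-trans (↭-reverse w) (↭-sym (sort-↭ w))) ⟩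
      map (complement w) (sort w)    ≡⟨ map-transport |s| s! ⟩
      reverse (sort w)               ↭⟨ ↭-reverse (sort w) ⟩
      sort w                         ↭⟨ sort-↭ w ⟩
      w                              ∎
      where open Perm.PermutationReasoning

    -- Reversal and complementation each exchange descents with ascents, so together they keep the
    -- number of descents.
    descents-reverseComplement : descents (reverseComplement w) ≡ descents w
    descents-reverseComplement = trans
      (steps-map drop (flip drop) (complement w) λ x∈ y∈ →
        drop-complement (Anyₚ.reverse⁻ x∈) (Anyₚ.reverse⁻ y∈))
      (steps-reverse (flip drop) w)
      where
      drop-complement : ∀ {x y} → x ∈ w → y ∈ w → drop (complement w x) (complement w y) ≡ drop y x
      drop-complement {x} {y} x∈ y∈ with <-cmp x y
      ... | tri< x<y _    _   = trans (drop-> (complement-anti x∈ y∈ x<y)) (sym (drop-> x<y))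
      ... | tri≈ _   refl _   = trans (drop-refl (complement w x)) (sym (drop-refl x))
      ... | tri> _   _    y<x = trans (drop-< (complement-anti y∈ x∈ y<x)) (sym (drop-< y<x))

  map-injective-local : {c : Fin n → Fin n} {u v : List (Fin n)} →
    (∀ {x y} → x ∈ u → y ∈ v → c x ≡ c y → x ≡ y) → map c u ≡ map c v → u ≡ v
  map-injective-local {u = []}    {[]}    _   _  = refl
  map-injective-local {u = x ∷ u} {y ∷ v} inj eq = cong₂ _∷_
    (inj (here refl) (here refl) (Listₚ.∷-injectiveˡ eq))
    (map-injective-local (λ x∈ y∈ → inj (there x∈) (there y∈)) (Listₚ.∷-injectiveʳ eq))

  -- Each word is a rearrangement of its image, so equal images force equal letters and hence one
  -- common complement; that map is injective on these letters.
  reverseComplement-injective : {w w′ : List (Fin n)} → Unique w → Unique w′ →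
    reverseComplement w ≡ reverseComplement w′ → w ≡ w′
  reverseComplement-injective {w} {w′} w! w′! eq = Listₚ.reverse-injective
    (map-injective-local
      (λ x∈ y∈ → complement-injective w! (Anyₚ.reverse⁻ x∈) (∈-resp-↭ (↭-sym w↭w′) (Anyₚ.reverse⁻ y∈)))
      (trans eq (cong (λ s → map (transport s (reverse s)) (reverse w′)) (sym (sort-cong w↭w′)))))
    where
    w↭w′ : w ↭ w′
    w↭w′ = ↭-trans (↭-sym (reverseComplement-↭ w!))
             (↭-trans (↭-reflexive eq) (reverseComplement-↭ w′!))

  -- `c` stands for the complement and `M` for membership in the block. The order `z y x` in `Q`
  -- accounts for the reversal.
  Dual : Pattern (Fin n) → Pattern (Fin n) → Set₁
  Dual P Q = ∀ (c : Fin n → Fin n) (M : Fin n → Set) →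
    (∀ {x y} → M x → M y → c x < c y → y < x) →
    ∀ {x y z} → M x → M y → M z → P (c x) (c y) (c z) → Q z y x

  Consecutive-reverseComplement⁻ : ∀ {P Q} → Dual P Q → ∀ {w} → Unique w →
    Consecutive P (reverseComplement w) → Consecutive Q w
  Consecutive-reverseComplement⁻ {P} {Q} dual {w} w! o =
    subst (Consecutive Q) (Listₚ.reverse-involutive w)
      (Consecutive-reverse {P = λ x y z → Q z y x}
        (Consecutive-map⁻
          (λ x∈ y∈ z∈ → dual (complement w) (_∈ w) (complement-anti⁻ w!) (Anyₚ.reverse⁻ x∈) (Anyₚ.reverse⁻ y∈) (Anyₚ.reverse⁻ z∈))
          o))

-- Reverse-complementing every block

infix 4 _⇝_

-- The graph of the block map. The bounds make `m` the largest letter of the list, so successive `m`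
-- are the right-to-left maxima.
data _⇝_ {n} : List (Fin n) → List (Fin n) → Set where
  []    : [] ⇝ []
  block : ∀ {w m r r′} → Unique w → All (_< m) w → All (_< m) r → r ⇝ r′ →
          w ++ m ∷ r ⇝ reverseComplement w ++ m ∷ r′

-- A new first letter below the leading maximum `m` joins the first block; one above `m` exceeds
-- every letter and forms a block of its own with `w` empty.
⇝-total : {l : List (Fin n)} → Unique l → ∃[ l′ ] l ⇝ l′
⇝-total [] = [] , []
⇝-total {l = x ∷ l} (x≢l ∷ l!) with ⇝-total l!
... | _ , [] = _ , block {w = []} [] [] [] []
... | _ , block {w} {m} {r} w! w<m r<m r⇝ with <-cmp x m
...   | tri< x<m _   _   = _ , block (Allₚ.++⁻ˡ w x≢l ∷ w!) (x<m ∷ w<m) r<m r⇝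
...   | tri≈ _   x≡m _   = contradiction x≡m (All.lookup x≢l (∈-++⁺ʳ w (here refl)))
...   | tri> _   _   m<x = _ , block {w = []} [] []
  (Allₚ.++⁺ (All.map (λ y<m → <-trans y<m m<x) w<m) (m<x ∷ All.map (λ y<m → <-trans y<m m<x) r<m))
  (block w! w<m r<m r⇝)

⇝⇒↭ : {l l′ : List (Fin n)} → l ⇝ l′ → l ↭ l′
⇝⇒↭ []                     = ↭-refl
⇝⇒↭ (block {m = m} w! _ _ r⇝) = Permₚ.++⁺ (↭-sym (reverseComplement-↭ w!)) (↭-prep m (⇝⇒↭ r⇝))

⇝-descents : {l l′ : List (Fin n)} → l ⇝ l′ → descents l ≡ descents l′
⇝-descents [] = refl
⇝-descents (block {w} {m} {r} {r′} w! w<m r<m r⇝) = begin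
  descents (w ++ m ∷ r)                                ≡⟨ split w r w<m ⟩
  descents w + descents (m ∷ r)                        ≡⟨ cong₂ _+_ (sym (descents-reverseComplement w!)) (descents-max-∷ r<m (⇝⇒↭ r⇝) (⇝-descents r⇝)) ⟩
  descents (reverseComplement w) + descents (m ∷ r′)   ≡⟨ split (reverseComplement w) r′ (All-resp-↭ (↭-sym (reverseComplement-↭ w!)) w<m) ⟨
  descents (reverseComplement w ++ m ∷ r′)             ∎
  where
  open ≡-Reasoning
  -- The step into `m` is an ascent and adds nothing, so the list can be cut at `m`.
  split : ∀ u v → All (_< m) u → descents (u ++ m ∷ v) ≡ descents u + descents (m ∷ v)
  split u v u<m = trans (steps-++ drop u m v) (cong (_+ _) (descents-∷ʳ-max u u<m))

-- Occurrences are pulled back from the image to the source, so that avoidance passes from the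
-- source to the image.
⇝-Occurrence⁻ : {P Q : Pattern (Fin n)} → Dual P Q → {l l′ : List (Fin n)} → l ⇝ l′ →
                Occurrence P l′ → Occurrence Q l
⇝-Occurrence⁻ dual (block {w} w! w<m r<m r⇝) o = Occurrence-block⁺ w w<m
  (Sum.map (Consecutive-reverseComplement⁻ dual w!) (⇝-Occurrence⁻ dual r⇝)
    (Occurrence-block⁻ (reverseComplement w) (All-resp-↭ (↭-sym (reverseComplement-↭ w!)) w<m)
      (All-resp-↭ (⇝⇒↭ r⇝) r<m) o))

-- If the cuts differed, each of `m` and `k` would lie in a part bounded by the other, giving both
-- `m < k` and `k < m`.
first-block-unique : {u v r s : List (Fin n)} {m k : Fin n} →
  All (_< m) u → All (_< m) r → All (_< k) v → All (_< k) s →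
  u ++ m ∷ r ≡ v ++ k ∷ s → u ≡ v × m ≡ k × r ≡ s
first-block-unique {u = []}    {[]}    _ _ _ _ refl = refl , refl , refl
first-block-unique {u = []}    {_ ∷ v} _ r<m (m<k ∷ _) _ refl =
  contradiction m<k (<-asym (All.lookup r<m (∈-++⁺ʳ v (here refl))))
first-block-unique {u = _ ∷ u} {[]}    (k<m ∷ _) _ _ s<k refl =
  contradiction k<m (<-asym (All.lookup s<k (∈-++⁺ʳ u (here refl))))
first-block-unique {u = x ∷ u} {y ∷ v} (_ ∷ u<m) r<m (_ ∷ v<k) s<k eq
  with refl , eq′ ← Listₚ.∷-injective eq
  with refl , m≡k , r≡s ← first-block-unique {u = u} {v} u<m r<m v<k s<k eq′ = refl , m≡k , r≡s

++-∷≢[] : ∀ (u : List A) {x v} → u ++ x ∷ v ≢ []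
++-∷≢[] []      ()
++-∷≢[] (_ ∷ _) ()

-- Rearranging a block or the remainder keeps the bounds by `m`, so the images are cut at the same
-- place and can be compared block by block.
⇝-injective : {l₁ l₂ l₁′ l₂′ : List (Fin n)} → l₁ ⇝ l₁′ → l₂ ⇝ l₂′ → l₁′ ≡ l₂′ → l₁ ≡ l₂
⇝-injective [] [] _ = refl
⇝-injective [] (block {w} _ _ _ _) eq = contradiction (sym eq) (++-∷≢[] (reverseComplement w))
⇝-injective (block {w} _ _ _ _) [] eq = contradiction eq (++-∷≢[] (reverseComplement w))
⇝-injective (block w! w<m r<m r⇝) (block v! v<k s<k s⇝) eq
  with first-block-unique (All-resp-↭ (↭-sym (reverseComplement-↭ w!)) w<m) (All-resp-↭ (⇝⇒↭ r⇝) r<m)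
                          (All-resp-↭ (↭-sym (reverseComplement-↭ v!)) v<k) (All-resp-↭ (⇝⇒↭ s⇝) s<k) eq
... | rc≡ , refl , r′≡ =
  cong₂ (λ u q → u ++ _ ∷ q) (reverseComplement-injective w! v! rc≡) (⇝-injective r⇝ s⇝ r′≡)

-- Vectors as lists

toList-Unique⁺ : {v : Vec A k} → VecUnique.Unique v → Unique (toList v)
toList-Unique⁺ []         = []
toList-Unique⁺ (px ∷ pxs) = VecAllₚ.toList⁺ px ∷ toList-Unique⁺ pxs

toList-Unique⁻ : {v : Vec A k} → Unique (toList v) → VecUnique.Unique v
toList-Unique⁻ {v = []}    []         = []
toList-Unique⁻ {v = _ ∷ _} (px ∷ pxs) = VecAllₚ.toList⁻ px ∷ toList-Unique⁻ pxs

toList-injective : {u v : Vec A k} → toList u ≡ toList v → u ≡ v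
toList-injective {u = u} {v} eq = trans (sym (Vecₚ.cast-is-id refl u)) (Vecₚ.toList-injective refl u v eq)

toList-surjective : (l : List A) → length l ≡ k → ∃[ v ] toList {n = k} v ≡ l
toList-surjective l refl = fromList l , Vecₚ.toList∘fromList l

length-filter-∷ : {P : A → Set} (P? : Decidable P) (x : A) (l : List A) →
  length (filter P? (x ∷ l)) ≡ (if does (P? x) then 1 else 0) + length (filter P? l)
length-filter-∷ P? x l with does (P? x)
... | true  = refl
... | false = refl

length-filter-map : {P : B → Set} (P? : Decidable P) (f : A → B) (l : List A) →
  length (filter P? (map f l)) ≡ length (filter (P? ∘ f) l)
length-filter-map P? f []      = refl
length-filter-map P? f (x ∷ l) with does (P? (f x))
... | true  = cong suc (length-filter-map P? f l)
... | false = length-filter-map P? f l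

des-toList : (v : Vec (Fin n) k) → des v ≡ descents (toList v)
des-toList []          = refl
des-toList (x ∷ [])    = refl
des-toList {k = suc (suc k)} (x ∷ y ∷ v) = begin
  length (filter P? (allFin (suc k)))                      ≡⟨ length-filter-∷ P? zero (tabulate suc) ⟩
  drop x y + length (filter P? (tabulate suc))             ≡⟨ cong (λ l → drop x y + length (filter P? l)) (Listₚ.map-tabulate id suc) ⟨
  drop x y + length (filter P? (map suc (allFin k)))       ≡⟨ cong (drop x y +_) (length-filter-map P? suc (allFin k)) ⟩
  -- Comparing shifted positions in `x ∷ y ∷ v` is comparing positions in `y ∷ v`, so the filtered
  -- count is already `des (y ∷ v)`.
  drop x y + des (y ∷ v)                                   ≡⟨ cong (drop x y +_) (des-toList (y ∷ v)) ⟩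
  drop x y + descents (y ∷ toList v)                       ∎
  where
  open ≡-Reasoning
  P? = λ i → lookup (x ∷ y ∷ v) (suc i) <? lookup (x ∷ y ∷ v) (inject₁ i)

-- `Occurs` forces the word and the alphabet to have the same length, which an
-- induction on the word cannot keep.
OccursIn : Vec (Fin 4) 4 → Vec (Fin n) k → Set
OccursIn ω v =
  ∃[ i ] ∃[ i′ ] ∃[ i″ ] ∃[ j ]
    toℕ i′ ≡ 1 + toℕ i × toℕ i″ ≡ 2 + toℕ i × i″ < j ×
    OrderIsomorphic (lookup v i ∷ lookup v i′ ∷ lookup v i″ ∷ lookup v j ∷ []) ω

Describes : Pattern (Fin n) → Vec (Fin 4) 4 → Set
Describes P ω = ∀ x y z d →
  OrderIsomorphic (x ∷ y ∷ z ∷ d ∷ []) ω ⇔ (P x y z × Above x y z d)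

module _ {P : Pattern (Fin n)} {ω : Vec (Fin 4) 4} (desc : Describes P ω) where

  Occurrence⇒OccursIn : (v : Vec (Fin n) k) → Occurrence P (toList v) → OccursIn ω v
  Occurrence⇒OccursIn (x ∷ y ∷ z ∷ v) (here p d) =
    0F , 1F , 2F , suc (suc (suc (VecAny.index d′))) , refl , refl , s≤s (s≤s (s≤s z≤n)) ,
    from (desc _ _ _ _) (p , VecAnyₚ.lookup-index d′)
    where d′ = VecAnyₚ.toList⁻ d
  Occurrence⇒OccursIn (x ∷ v) (there o) with Occurrence⇒OccursIn v o
  ... | i , i′ , i″ , j , e , e′ , lt , iso =
    suc i , suc i′ , suc i″ , suc j , cong suc e , cong suc e′ , s≤s lt , iso

  OccursIn⇒Occurrence : (v : Vec (Fin n) k) → OccursIn ω v → Occurrence P (toList v)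
  OccursIn⇒Occurrence (x ∷ y ∷ z ∷ v) (zero , suc zero , suc (suc zero) , suc (suc (suc j)) , _ , _ , _ , iso)
    with p , d ← to (desc _ _ _ _) iso =
    here p (VecAnyₚ.toList⁺ (VecAny.map (λ { refl → d }) (VecMembershipₚ.∈-lookup j v)))
  OccursIn⇒Occurrence (x ∷ v) (zero , suc (suc i′) , i″ , j , () , _)
  OccursIn⇒Occurrence (x ∷ y ∷ []) (zero , suc zero , zero , j , _ , () , _)
  OccursIn⇒Occurrence (x ∷ y ∷ []) (zero , suc zero , suc zero , j , _ , () , _)
  OccursIn⇒Occurrence (x ∷ y ∷ z ∷ v) (zero , suc zero , suc (suc zero) , suc zero , _ , _ , s≤s () , _)
  OccursIn⇒Occurrence (x ∷ y ∷ z ∷ v) (zero , suc zero , suc (suc zero) , suc (suc zero) , _ , _ , s≤s (s≤s ()) , _)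
  OccursIn⇒Occurrence (x ∷ v) (suc i , suc i′ , suc i″ , suc j , e , e′ , s≤s lt , iso) =
    there (OccursIn⇒Occurrence v (i , i′ , i″ , j , ℕₚ.suc-injective e , ℕₚ.suc-injective e′ , lt , iso))

-- Looking up in an increasing `c` preserves and reflects the order. With `c` the sorted letters of
-- an occurrence, reading `c` through `ω` recovers the occurrence itself.
orderIsomorphic-increasing : {c : Vec (Fin n) k} {ω : Vec (Fin k) k} → Linked _<_ c →
  OrderIsomorphic (Vec.map (lookup c) ω) ω
orderIsomorphic-increasing {c = c} {ω} c↗ a b
  rewrite Vecₚ.lookup-map a (lookup c) ω | Vecₚ.lookup-map b (lookup c) ω =
  mk⇔ reflects (Linkedₚ.lookup⁺ <-trans c↗)
  where
  reflects : ∀ {i j} → lookup c i < lookup c j → i < j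
  reflects {i} {j} lt with <-cmp i j
  ... | tri< i<j _    _   = i<j
  ... | tri≈ _   refl _   = contradiction lt (<-irrefl refl)
  ... | tri> _   _    j<i = contradiction lt (<-asym (Linkedₚ.lookup⁺ <-trans c↗ j<i))

-- The patterns 213 and 132

213-pattern 132-pattern : Pattern (Fin n)
213-pattern x y z = y < x × x < z
132-pattern x y z = x < z × z < y

213-describes : Describes {n} 213-pattern (1F ∷ 0F ∷ 2F ∷ 3F ∷ [])
213-describes x y z d = mk⇔
  (λ iso → (from (iso 1F 0F) (s≤s z≤n) , from (iso 0F 2F) (s≤s (s≤s z≤n))) ,
           (from (iso 0F 3F) (s≤s (s≤s z≤n)) , from (iso 1F 3F) (s≤s z≤n) , from (iso 2F 3F) (s≤s (s≤s (s≤s z≤n)))))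
  (λ ((y<x , x<z) , _ , _ , z<d) →
    orderIsomorphic-increasing {c = y ∷ x ∷ z ∷ d ∷ []} {1F ∷ 0F ∷ 2F ∷ 3F ∷ []} (y<x ∷ x<z ∷ z<d ∷ [-]))

132-describes : Describes {n} 132-pattern (0F ∷ 2F ∷ 1F ∷ 3F ∷ [])
132-describes x y z d = mk⇔
  (λ iso → (from (iso 0F 2F) (s≤s z≤n) , from (iso 2F 1F) (s≤s (s≤s z≤n))) ,
           (from (iso 0F 3F) (s≤s z≤n) , from (iso 1F 3F) (s≤s (s≤s (s≤s z≤n))) , from (iso 2F 3F) (s≤s (s≤s z≤n))))
  (λ ((x<z , z<y) , _ , y<d , _) →
    orderIsomorphic-increasing {c = x ∷ z ∷ y ∷ d ∷ []} {0F ∷ 2F ∷ 1F ∷ 3F ∷ []} (x<z ∷ z<y ∷ y<d ∷ [-]))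

-- From `c x < c z < c y` follows `y < z < x`, and then `z y x` has the shape 213.
213-dual : Dual {n} 132-pattern 213-pattern
213-dual c M anti x∈ y∈ z∈ (x<z , z<y) = anti z∈ y∈ z<y , anti x∈ z∈ x<z

132-dual : Dual {n} 213-pattern 132-pattern
132-dual c M anti x∈ y∈ z∈ (y<x , x<z) = anti x∈ z∈ x<z , anti y∈ x∈ y<x

-- Comparing the two avoidance classes

avoiders : Vec (Fin 4) 4 → ∀ n → ℕ → List (Vec (Fin n) n)
avoiders ω n m = filter (λ π → des π ℕₚ.≟ m) (𝔖[ ω ] n)

∈-avoiders : (ω : Vec (Fin 4) 4) (m : ℕ) {π : Vec (Fin n) n} →
             π ∈ avoiders ω n m ⇔ (VecUnique.Unique π × Avoids ω π × des π ≡ m)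
∈-avoiders {n} ω m {π} = mk⇔ split
  (λ (π! , av , d) → ∈-filter⁺ (λ π → des π ℕₚ.≟ m) (∈-filter⁺ (avoids? ω) (from ∈-𝔖 π!) av) d)
  where
  split : π ∈ avoiders ω n m → VecUnique.Unique π × Avoids ω π × des π ≡ m
  split π∈ =
    let π∈av , d  = ∈-filter⁻ (λ π → des π ℕₚ.≟ m) {xs = 𝔖[ ω ] n} π∈
        π∈𝔖  , av = ∈-filter⁻ (avoids? ω) {xs = 𝔖 n} π∈av
    in to ∈-𝔖 π∈𝔖 , av , d

-- The block map is injective, keeps `des`, and takes words avoiding `ω′` to words avoiding `ω`.
avoiders-≤ : {P Q : Pattern (Fin n)} (ω ω′ : Vec (Fin 4) 4) →
  Describes P ω → Describes Q ω′ → Dual P Q → ∀ m →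
  length (avoiders ω′ n m) ≤ length (avoiders ω n m)
avoiders-≤ {n} ω ω′ descP descQ dual m =
  length-≤ (λ π σ → toList π ⇝ toList σ)
    (Uniqueₚ.filter⁺ _ (Uniqueₚ.filter⁺ (avoids? ω′) (𝔖-unique n)))
    (λ π∈ → map₂ (λ (good , π⇝σ) → from (∈-avoiders ω m) good , π⇝σ) (image (to (∈-avoiders ω′ m) π∈)))
    (λ r r′ → toList-injective (⇝-injective r r′ refl))
  where
  image : ∀ {π} → VecUnique.Unique π × Avoids ω′ π × des π ≡ m →
          ∃[ σ ] (VecUnique.Unique σ × Avoids ω σ × des σ ≡ m) × toList π ⇝ toList σ
  image {π} (π! , av , refl)
    with l , π⇝l ← ⇝-total (toList-Unique⁺ π!)
    with σ , refl ← toList-surjective l (trans (sym (↭-length (⇝⇒↭ π⇝l))) (Vecₚ.length-toList π)) =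
    σ ,
    ( toList-Unique⁻ (Unique-resp-↭ (⇝⇒↭ π⇝l) (toList-Unique⁺ π!))
    -- An occurrence of `ω` in `σ` is read as one of `P` in its list, pulled back to one of `Q` in
    -- `π`, and read as one of `ω′`, which `av` excludes.
    , av ∘ Occurrence⇒OccursIn {ω = ω′} descQ π ∘ ⇝-Occurrence⁻ dual π⇝l ∘ OccursIn⇒Occurrence {ω = ω} descP σ
    , trans (des-toList σ) (trans (sym (⇝-descents π⇝l)) (sym (des-toList π))) ) ,
    π⇝l

theorem3p5 : (1F ∷ 0F ∷ 2F ∷ 3F ∷ []) ∼des (0F ∷ 2F ∷ 1F ∷ 3F ∷ [])
-- The duality holds in both directions, so the block map injects each class into the other.
theorem3p5 n m _ = ℕₚ.≤-antisym
  (avoiders-≤ {n} (0F ∷ 2F ∷ 1F ∷ 3F ∷ []) (1F ∷ 0F ∷ 2F ∷ 3F ∷ []) 132-describes 213-describes 213-dual m)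
  (avoiders-≤ {n} (1F ∷ 0F ∷ 2F ∷ 3F ∷ []) (0F ∷ 2F ∷ 1F ∷ 3F ∷ []) 213-describes 132-describes 132-dual m)
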